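{- Let $n,k,d$ be integers with $k\geq d\geq 3$ and $n\geq\frac{dk}{d-1}$, and let $\mathcal{F}\subseteq \binom{[n]}{k}$ be a stable family of $k$-subsets of $[n]$ such that, for all distinct sets $A_1,\ldots,A_d \in\mathcal{F}$, \[ A_1\cap\cdots\cap A_d \neq \emptyset \quad\text{whenever}\quad |A_1\cup \cdots\cup A_d| \leq 2k-(d-2). \] Then \[ |\mathcal{F}| \leq \binom{n-1}{k-1}. \] Furthermore, equality holds if and only if $\mathcal{F}$ is a star.
   Context: $[n]=\{1,\ldots,n\}$ and $\binom{[n]}{k}$ is the family of all $k$-element subsets of $[n]$. A star is a family consisting of all $k$-element subsets of $[n]$ that contain some fixed element of $[n]$. For $i,j\in[n]$, the $(i,j)$-shift of a family $\mathcal{F}\subseteq 2^{[n]}$ is $S_{ij}(\mathcal{F}) = \{S_{ij}(A) : A\in\mathcal{F}\}$, where for $A\in\mathcal{F}$, $S_{ij}(A) = A' := (A\setminus\{j\})\cup\{i\}$ if $j\in A$, $i\notin A$ and $A'\notin\mathcal{F}$, and $S_{ij}(A)=A$ otherwise. The family $\mathcal{F}$ is stable if $S_{ij}(\mathcal{F})=\mathcal{F}$ whenever $1\leq i<j\leq n$. -}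

module Defs where

open import Data.Bool.Base using (if_then_else_)
import Data.Bool.Properties as Bool
open import Data.Fin.Base using (Fin; _<_)
open import Data.Fin.Subset using (Subset; _∈_; _∪_; _-_; ⁅_⁆; ∣_∣; ⋃; ⋂; Nonempty)
open import Data.Fin.Subset.Properties using (_∈?_)
open import Data.List.Base using (List; map; tabulate)
import Data.List.Membership.Propositional as List
import Data.List.Membership.DecPropositional as DecMembership
open import Data.List.Relation.Binary.BagAndSetEquality using (_∼[_]_; set)
open import Data.List.Relation.Unary.All using (All)
open import Data.Nat.Base using (ℕ; _*_; _∸_; _≤_)
open import Data.Product.Base using (∃; _×_)
open import Data.Vec.Properties using (≡-dec)
open import Function.Bundles using (_⇔_)
open import Function.Definitions using (Injective)
open import Relation.Binary.Definitions using (DecidableEquality)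
open import Relation.Binary.PropositionalEquality.Core using (_≡_)
open import Relation.Nullary.Decidable using (Dec; does; ¬?; _×-dec_)

private
  variable
    n : ℕ

-- A family of subsets of [n], given by a list of its members. The ground set
-- [n] = {1, …, n} is Fin n, with i ∈ [n] represented by the index i - 1.
-- The list may be taken up to order and repetition; `length` is the
-- cardinality of the family only when the list is `Unique`.
Family : ℕ → Set
Family n = List (Subset n)

infix 4 _∈ᶠ_ _∈ᶠ?_

_∈ᶠ_ : Subset n → Family n → Set
A ∈ᶠ F = A List.∈ F

_≟ˢ_ : DecidableEquality (Subset n)
_≟ˢ_ = ≡-dec Bool._≟_

_∈ᶠ?_ : (A : Subset n) (F : Family n) → Dec (A ∈ᶠ F)
_∈ᶠ?_ = DecMembership._∈?_ _≟ˢ_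

Uniform : ℕ → Family n → Set
Uniform k F = All (λ A → ∣ A ∣ ≡ k) F

replace : Fin n → Fin n → Subset n → Subset n
replace i j A = (A - j) ∪ ⁅ i ⁆

-- S_ij(A), which depends on the family F containing A.
shiftSet : Family n → Fin n → Fin n → Subset n → Subset n
shiftSet F i j A =
  if does ((j ∈? A) ×-dec ¬? (i ∈? A) ×-dec ¬? (replace i j A ∈ᶠ? F))
  then replace i j A
  else A

shift : Fin n → Fin n → Family n → Family n
shift i j F = map (shiftSet F i j) F

Stable : Family n → Set
Stable {n} F = ∀ (i j : Fin n) → i < j → shift i j F ∼[ set ] F

-- The truncated subtractions are exact for 2 ≤ d ≤ k.
IntersectionCondition : ℕ → ℕ → Family n → Set
IntersectionCondition {n} k d F =
  (A : Fin d → Subset n) → Injective _≡_ _≡_ A → (∀ i → A i ∈ᶠ F) →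
  ∣ ⋃ (tabulate A) ∣ ≤ 2 * k ∸ (d ∸ 2) → Nonempty (⋂ (tabulate A))

IsStar : ℕ → Family n → Set
IsStar {n} k F = ∃ λ (x : Fin n) → ∀ (A : Subset n) → A ∈ᶠ F ⇔ (∣ A ∣ ≡ k × x ∈ A)

{-# OPTIONS --safe #-}
-- Let d = c + 1, s = n - k and let 0 be the least element. It suffices that at least
-- as many k-sets are missing from F as there are k-sets avoiding 0, with strict
-- inequality if d ≥ 3 and some member avoids 0. This is shown for d ≥ 1, k ≥ d - 1 and
-- k ≤ cs, by induction on d and then on n.
--
-- If k = c and e ∈ F avoids 0, stability puts all k-subsets of e ∪ {0} into F; these
-- are d sets without common element. So every member contains 0.
--
-- If k ≤ c(s - 1), split F according to the last element. Both parts inherit the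
-- hypotheses: d complements of size s cannot be disjoint in [n - 1], which leaves room
-- to shift the last element of one of the sets to an element missing from two of them.
--
-- Otherwise n ≤ 2k - (d - 2), so any d members of F meet. For e ∈ F avoiding 0 the link
-- {A ⊆ e : A ∪ ∁ e ∈ F} satisfies the hypotheses for d - 1, k - s and the same s, which
-- bounds from below the number of k-sets b ∉ F with b ⊇ ∁ e. Counting the pairs (e, b)
-- from both sides gives the bound.
module Submission where

open import Defs
open import Algebra.Properties.CommutativeSemigroup using (interchange)
open import Data.Bool.Base using (Bool; T; true; false; not; _∧_; _∨_)
import Data.Bool.Properties as Bool
open import Data.Empty as Empty using (⊥-elim)
open import Data.Fin.Base as Fin using (Fin; zero; suc; inject₁; fromℕ)
import Data.Fin.Properties as Fin
open import Data.Fin.Relation.Unary.Top using (View; view; ‵fromℕ; ‵inject₁)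
open import Data.Fin.Subset
  using (Subset; inside; outside; _∈_; _∉_; _⊆_; _∪_; _∩_; _-_; ∁; ⊤; ⊥; ⁅_⁆; ∣_∣; ⋃; ⋂; Nonempty)
open import Data.Fin.Subset.Properties
open import Data.List.Base using ([]; _∷_; length; tabulate)
open import Data.List.Membership.Propositional.Properties using (∈-map⁺)
import Data.List.Relation.Unary.All as All
open import Data.List.Relation.Unary.AllPairs using ([]; _∷_)
open import Data.List.Relation.Unary.Unique.Propositional using (Unique)
open import Data.Nat.Base
open import Data.Nat.Combinatorics using (_C_; nCk+nC[k+1]≡[n+1]C[k+1])
open import Data.Nat.Properties
open import Data.Product.Base using (_×_; _,_; ∃; ∃₂; proj₁; proj₂)
open import Data.Sum.Base as Sum using (_⊎_; inj₁; inj₂)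
open import Data.Unit.Base using (tt)
open import Data.Vec.Base using ([]; _∷_; _∷ʳ_; insertAt; initLast; here; there)
open import Data.Vec.Properties using (∷-injectiveˡ; ∷-injectiveʳ; ∷ʳ-injectiveˡ; ∷ʳ-injectiveʳ)
open import Function.Base using (_∘_)
open import Function.Bundles using (_⇔_; mk⇔; Equivalence)
open import Function.Definitions using (Injective)
open import Relation.Binary.PropositionalEquality
open import Relation.Nullary using (Dec; ¬_; yes; no; does; contradiction)
open import Relation.Nullary.Decidable using (_×-dec_; ¬?; does-⇔; decidable-stable; dec-true; dec-false)

private
  variable
    m n k c : ℕ
    p q r : Subset n
    f g : Subset n → Bool
    u v : Subset n → ℕ

-- Sums over all subsets

∑ : (Subset n → ℕ) → ℕ
∑ {zero}  u = u []
∑ {suc n} u = ∑ (u ∘ (inside ∷_)) + ∑ (u ∘ (outside ∷_))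

𝟙 : Bool → ℕ
𝟙 true  = 1
𝟙 false = 0

∑-cong : (∀ A → u A ≡ v A) → ∑ u ≡ ∑ v
∑-cong {zero}  h = h []
∑-cong {suc n} h = cong₂ _+_ (∑-cong (h ∘ (inside ∷_))) (∑-cong (h ∘ (outside ∷_)))

∑-mono : (∀ A → u A ≤ v A) → ∑ u ≤ ∑ v
∑-mono {zero}  h = h []
∑-mono {suc n} h = +-mono-≤ (∑-mono (h ∘ (inside ∷_))) (∑-mono (h ∘ (outside ∷_)))

+-tight : ∀ {a b c d} → a ≤ b → c ≤ d → b + d ≤ a + c → b ≤ a × d ≤ c
+-tight {a} {b} {c} {d} a≤b c≤d le =
  +-cancelʳ-≤ d b a (≤-trans le (+-monoʳ-≤ a c≤d)) ,
  +-cancelˡ-≤ b d c (≤-trans le (+-monoˡ-≤ c a≤b))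

∑-tight : (∀ A → u A ≤ v A) → ∑ v ≤ ∑ u → ∀ A → u A ≡ v A
∑-tight {zero}  h le [] = ≤-antisym (h []) le
∑-tight {suc n} h le (b ∷ A)
  with +-tight (∑-mono (h ∘ (inside ∷_))) (∑-mono (h ∘ (outside ∷_))) le
∑-tight {suc n} h le (true  ∷ A) | le₁ , le₀ = ∑-tight (h ∘ (inside ∷_)) le₁ A
∑-tight {suc n} h le (false ∷ A) | le₁ , le₀ = ∑-tight (h ∘ (outside ∷_)) le₀ A

+-interchange : ∀ a b c d → (a + b) + (c + d) ≡ (a + c) + (b + d)
+-interchange = interchange +-commutativeSemigroup

∑-+ : (u v : Subset n → ℕ) → ∑ (λ A → u A + v A) ≡ ∑ u + ∑ v
∑-+ {zero}  u v = refl
∑-+ {suc n} u v = trans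
  (cong₂ _+_ (∑-+ (u ∘ (inside ∷_)) (v ∘ (inside ∷_))) (∑-+ (u ∘ (outside ∷_)) (v ∘ (outside ∷_))))
  (+-interchange (∑ (u ∘ (inside ∷_))) _ _ _)

∑-*ˡ : ∀ b (u : Subset n → ℕ) → ∑ (λ A → b * u A) ≡ b * ∑ u
∑-*ˡ {zero}  b u = refl
∑-*ˡ {suc n} b u = trans
  (cong₂ _+_ (∑-*ˡ b (u ∘ (inside ∷_))) (∑-*ˡ b (u ∘ (outside ∷_))))
  (sym (*-distribˡ-+ b _ _))

∑-*ʳ : ∀ b (u : Subset n → ℕ) → ∑ (λ A → u A * b) ≡ ∑ u * b
∑-*ʳ b u = trans (∑-cong (λ A → *-comm (u A) b)) (trans (∑-*ˡ b u) (*-comm b _))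

∑-0 : ∑ {n} (λ _ → 0) ≡ 0
∑-0 {n} = ∑-*ˡ {n} 0 (λ _ → 0)

∑-swap : (w : Subset m → Subset n → ℕ) → ∑ (λ A → ∑ (w A)) ≡ ∑ (λ B → ∑ (λ A → w A B))
∑-swap {zero}  w = refl
∑-swap {suc m} w = trans
  (cong₂ _+_ (∑-swap (w ∘ (inside ∷_))) (∑-swap (w ∘ (outside ∷_))))
  (sym (∑-+ (λ B → ∑ (λ A → w (inside ∷ A) B)) (λ B → ∑ (λ A → w (outside ∷ A) B))))

∑-∷ʳ : (u : Subset (suc n) → ℕ) → ∑ u ≡ ∑ (λ A → u (A ∷ʳ inside)) + ∑ (λ A → u (A ∷ʳ outside))
∑-∷ʳ {zero}  u = refl
∑-∷ʳ {suc n} u = trans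
  (cong₂ _+_ (∑-∷ʳ (u ∘ (inside ∷_))) (∑-∷ʳ (u ∘ (outside ∷_))))
  (+-interchange (∑ (λ A → u (inside ∷ (A ∷ʳ inside)))) _ _ _)

∑-insertAt : (u : Subset (suc n) → ℕ) (x : Fin (suc n)) →
  ∑ u ≡ ∑ (λ A → u (insertAt A x inside)) + ∑ (λ A → u (insertAt A x outside))
∑-insertAt         u zero    = refl
∑-insertAt {suc n} u (suc x) = trans
  (cong₂ _+_ (∑-insertAt (u ∘ (inside ∷_)) x) (∑-insertAt (u ∘ (outside ∷_)) x))
  (+-interchange (∑ (λ A → u (inside ∷ insertAt A x inside))) _ _ _)

-- Layers and the sets missing from a family

layer : ℕ → ℕ → ℕ
layer n k = ∑ {n} (λ A → 𝟙 (∣ A ∣ ≡ᵇ k))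

layer≡C : ∀ n k → layer n k ≡ n C k
layer≡C zero    zero    = refl
layer≡C zero    (suc k) = refl
layer≡C (suc n) zero    = cong₂ _+_ (∑-0 {n}) (layer≡C n 0)
layer≡C (suc n) (suc k) =
  trans (cong₂ _+_ (layer≡C n k) (layer≡C n (suc k))) (nCk+nC[k+1]≡[n+1]C[k+1] n k)

layer-pos : ∀ k s → 0 < layer (k + s) k
layer-pos zero    zero    = s≤s z≤n
layer-pos zero    (suc s) = ≤-trans (layer-pos zero s) (m≤n+m _ (∑ {s} (λ _ → 0)))
layer-pos (suc k) s       = ≤-trans (layer-pos k s) (m≤m+n _ _)

-- Counting non-members recasts the upper bound on the family as a lower bound by the number of
-- `k`-sets avoiding 0. This form adds up over the last element and can be read off the links.
missing : ℕ → (Subset n → Bool) → Subset n → Bool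
missing k f A = (∣ A ∣ ≡ᵇ k) ∧ not (f A)

#missing : ℕ → (Subset n → Bool) → ℕ
#missing k f = ∑ (𝟙 ∘ missing k f)

≡ᵇ-true : ∀ {a b} → a ≡ b → (a ≡ᵇ b) ≡ true
≡ᵇ-true {a} {b} = dec-true (a ≟ b)

≡ᵇ-⇔ : ∀ {a b a′ b′} → (a ≡ b → a′ ≡ b′) → (a′ ≡ b′ → a ≡ b) → (a ≡ᵇ b) ≡ (a′ ≡ᵇ b′)
≡ᵇ-⇔ {a} {b} {a′} {b′} to from = does-⇔ (mk⇔ to from) (a ≟ b) (a′ ≟ b′)

≡ᵇ-true⁻ : ∀ a b → (a ≡ᵇ b) ≡ true → a ≡ b
≡ᵇ-true⁻ a b eq = ≡ᵇ⇒≡ a b (subst T (sym eq) tt)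

missing⁺ : ∀ {A : Subset n} → ∣ A ∣ ≡ k → f A ≡ false → missing k f A ≡ true
missing⁺ size eq rewrite ≡ᵇ-true size | eq = refl

missing⁻ : ∀ (f : Subset n → Bool) {A} → missing k f A ≡ true → ∣ A ∣ ≡ k × f A ≡ false
missing⁻ {k = k} f {A} eq with ∣ A ∣ ≡ᵇ k in size | f A
... | true | false = ≡ᵇ-true⁻ ∣ A ∣ k size , refl

𝟙-inj : ∀ {b} → 𝟙 b ≡ 1 → b ≡ true
𝟙-inj {true} _ = refl

UniformFor : ℕ → (Subset n → Bool) → Set
UniformFor k f = ∀ {A} → f A ≡ true → ∣ A ∣ ≡ k

layer-split : UniformFor {n} k f → layer n k ≡ ∑ (𝟙 ∘ f) + #missing k f
layer-split {n} {k} {f} uniform =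
  trans (∑-cong pointwise) (∑-+ (𝟙 ∘ f) (𝟙 ∘ missing k f))
  where
  pointwise : ∀ A → 𝟙 (∣ A ∣ ≡ᵇ k) ≡ 𝟙 (f A) + 𝟙 (missing k f A)
  pointwise A with f A in eq
  ... | true  rewrite ≡ᵇ-true (uniform eq) = refl
  ... | false with ∣ A ∣ ≡ᵇ k
  ...   | true  = refl
  ...   | false = refl

-- Elementary moves

infix 4 _⋖_ _⊲_

data _⋖_ : Subset n → Subset n → Set where
  add  : outside ∷ p ⋖ inside ∷ p
  skip : ∀ {b} → p ⋖ q → b ∷ p ⋖ b ∷ q

-- p ⊲ q: p arises from q by replacing one element by a smaller one.
data _⊲_ : Subset n → Subset n → Set where
  move : p ⋖ q → inside ∷ p ⊲ outside ∷ q
  skip : ∀ {b} → p ⊲ q → b ∷ p ⊲ b ∷ q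

⋖-card : p ⋖ q → suc ∣ p ∣ ≡ ∣ q ∣
⋖-card add                  = refl
⋖-card (skip {b = true}  l) = cong suc (⋖-card l)
⋖-card (skip {b = false} l) = ⋖-card l

added : {p q : Subset n} → p ⋖ q → Fin n
added add      = zero
added (skip l) = suc (added l)

added∈ : (l : p ⋖ q) → added l ∈ q
added∈ add      = here
added∈ (skip l) = there (added∈ l)

added∉ : (l : p ⋖ q) → added l ∉ p
added∉ (skip l) (there x∈p) = added∉ l x∈p

-added : (l : p ⋖ q) → q - added l ≡ p
-added (add {p = p})        = cong (outside ∷_) (p─⊥≡p p)
-added (skip {b = true}  l) = cong (inside ∷_) (-added l)
-added (skip {b = false} l) = cong (outside ∷_) (-added l)

p-x⋖p : ∀ {x} {p : Subset n} → x ∈ p → p - x ⋖ p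
p-x⋖p {p = _ ∷ p} here = subst (λ r → outside ∷ r ⋖ inside ∷ p) (sym (p─⊥≡p p)) add
p-x⋖p {p = _ ∷ p} (there x∈p) = skip (p-x⋖p x∈p)

x∉p-x : ∀ {x} (p : Subset n) → x ∉ p - x
x∉p-x {x = suc x} (b ∷ p) (there x∈) = x∉p-x p x∈

p⋖p∪x : ∀ {x} {p : Subset n} → x ∉ p → p ⋖ p ∪ ⁅ x ⁆
p⋖p∪x {x = zero}  {true  ∷ p} x∉p = ⊥-elim (x∉p here)
p⋖p∪x {x = zero}  {false ∷ p} x∉p rewrite ∪-identityʳ p = add
p⋖p∪x {x = suc x} {b ∷ p} x∉p rewrite Bool.∨-identityʳ b = skip (p⋖p∪x (x∉p ∘ there))

⋖-below : (q : Subset n) → 0 < ∣ q ∣ → ∃ (_⋖ q)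
⋖-below (true  ∷ q) _   = outside ∷ q , add
⋖-below (false ∷ q) pos with ⋖-below q pos
... | p , l = outside ∷ p , skip l

⋖-above : (p : Subset n) → ∣ p ∣ < n → ∃ (p ⋖_)
⋖-above (false ∷ p) _        = inside ∷ p , add
⋖-above (true  ∷ p) (s≤s lt) with ⋖-above p lt
... | q , l = inside ∷ q , skip l

last-⋖ : (p : Subset n) → p ∷ʳ outside ⋖ p ∷ʳ inside
last-⋖ []      = add
last-⋖ (b ∷ p) = skip (last-⋖ p)

∷ʳ-⋖ : ∀ {b} → p ⋖ q → p ∷ʳ b ⋖ q ∷ʳ b
∷ʳ-⋖ add      = add
∷ʳ-⋖ (skip l) = skip (∷ʳ-⋖ l)

∷ʳ-⊲ : ∀ {b} → p ⊲ q → p ∷ʳ b ⊲ q ∷ʳ b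
∷ʳ-⊲ (move l) = move (∷ʳ-⋖ l)
∷ʳ-⊲ (skip l) = skip (∷ʳ-⊲ l)

-- The last element is the largest, so trading it for any absent element is a move downwards.
⋖⇒∷ʳ-⊲ : p ⋖ q → q ∷ʳ outside ⊲ p ∷ʳ inside
⋖⇒∷ʳ-⊲ (add {p = p}) = move (last-⋖ p)
⋖⇒∷ʳ-⊲ (skip l)      = skip (⋖⇒∷ʳ-⊲ l)

⊲⇒replace : {p q : Subset n} → p ⊲ q →
  ∃₂ λ i j → i Fin.< j × j ∈ q × i ∉ q × replace i j q ≡ p
⊲⇒replace (move l) = zero , suc (added l) , s≤s z≤n , there (added∈ l) , (λ ()) ,
  cong (inside ∷_) (trans (∪-identityʳ _) (-added l))
⊲⇒replace (skip {b = b} l) with ⊲⇒replace l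
... | i , j , i<j , j∈q , i∉q , eq =
  suc i , suc j , s≤s i<j , there j∈q , i∉q ∘ drop-there , cong₂ _∷_ (Bool.∨-identityʳ b) eq

-- Cardinalities and sets of intermediate size

∣∪∣+∣∩∣ : (p q : Subset n) → ∣ p ∪ q ∣ + ∣ p ∩ q ∣ ≡ ∣ p ∣ + ∣ q ∣
∣∪∣+∣∩∣ []          []          = refl
∣∪∣+∣∩∣ (true  ∷ p) (true  ∷ q) = cong suc
  (trans (+-suc _ _) (trans (cong suc (∣∪∣+∣∩∣ p q)) (sym (+-suc _ _))))
∣∪∣+∣∩∣ (true  ∷ p) (false ∷ q) = cong suc (∣∪∣+∣∩∣ p q)
∣∪∣+∣∩∣ (false ∷ p) (true  ∷ q) = trans (cong suc (∣∪∣+∣∩∣ p q)) (sym (+-suc _ _))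
∣∪∣+∣∩∣ (false ∷ p) (false ∷ q) = ∣∪∣+∣∩∣ p q

∣p∪q∣≤∣p∣+∣q∣ : (p q : Subset n) → ∣ p ∪ q ∣ ≤ ∣ p ∣ + ∣ q ∣
∣p∪q∣≤∣p∣+∣q∣ p q = ≤-trans (m≤m+n _ _) (≤-reflexive (∣∪∣+∣∩∣ p q))

∣∁p∣+∣p∣≡n : (p : Subset n) → ∣ ∁ p ∣ + ∣ p ∣ ≡ n
∣∁p∣+∣p∣≡n []          = refl
∣∁p∣+∣p∣≡n (true  ∷ p) = trans (+-suc _ _) (cong suc (∣∁p∣+∣p∣≡n p))
∣∁p∣+∣p∣≡n (false ∷ p) = cong suc (∣∁p∣+∣p∣≡n p)

between : {p q : Subset n} → p ⊆ q → ∀ j → ∣ p ∣ ≤ j → j ≤ ∣ q ∣ →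
  ∃ λ r → p ⊆ r × r ⊆ q × ∣ r ∣ ≡ j
between {p = []}        {[]}        p⊆q zero    _         _         = [] , (λ x → x) , (λ x → x) , refl
between {p = true  ∷ p} {true  ∷ q} p⊆q (suc j) (s≤s p≤j) (s≤s j≤q)
  with between (drop-∷-⊆ p⊆q) j p≤j j≤q
... | r , p⊆r , r⊆q , size = inside ∷ r , s⊆s p⊆r , s⊆s r⊆q , cong suc size
between {p = true  ∷ p} {false ∷ q} p⊆q _ _ _ with () ← p⊆q here
between {p = false ∷ p} {false ∷ q} p⊆q j p≤j j≤q
  with between (drop-∷-⊆ p⊆q) j p≤j j≤q
... | r , p⊆r , r⊆q , size = outside ∷ r , s⊆s p⊆r , s⊆s r⊆q , size
between {p = false ∷ p} {true  ∷ q} p⊆q j p≤j j≤q with j ≤? ∣ q ∣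
... | yes j≤q′ with between (drop-∷-⊆ p⊆q) j p≤j j≤q′
...   | r , p⊆r , r⊆q , size = outside ∷ r , s⊆s p⊆r , out⊆ r⊆q , size
between {p = false ∷ p} {true  ∷ q} p⊆q j p≤j j≤q | no j≰q =
  inside ∷ q , out⊆ (drop-∷-⊆ p⊆q) , (λ x → x) , ≤-antisym (≰⇒> j≰q) j≤q

-- Sets with a common lower cover `r` differ by swapping at most one element: adjacency in the
-- Johnson graph.
Exchangeable : (Subset n → Set) → Set
Exchangeable P = ∀ {r p q} → r ⋖ p → r ⋖ q → P p → P q

-- If the heads differ, first make the larger tail contain the other one minus
-- an element, then exchange the head for that element.
exchange-connected : (P : Subset n → Set) → Exchangeable P →
  ∀ p q → ∣ p ∣ ≡ ∣ q ∣ → P p → P q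
exchange-connected P ex []          []          _  h = h
exchange-connected P ex (true  ∷ p) (true  ∷ q) eq h =
  exchange-connected (P ∘ (inside ∷_)) (λ l l′ → ex (skip l) (skip l′)) p q (suc-injective eq) h
exchange-connected P ex (false ∷ p) (false ∷ q) eq h =
  exchange-connected (P ∘ (outside ∷_)) (λ l l′ → ex (skip l) (skip l′)) p q eq h
exchange-connected P ex (true  ∷ p) (false ∷ q) eq h with ⋖-below q (≤-trans (s≤s z≤n) (≤-reflexive eq))
... | r , l = ex add (skip l)
  (exchange-connected (P ∘ (inside ∷_)) (λ l l′ → ex (skip l) (skip l′)) p r
    (suc-injective (trans eq (sym (⋖-card l)))) h)
exchange-connected P ex (false ∷ p) (true  ∷ q) eq h with ⋖-below p (≤-trans (s≤s z≤n) (≤-reflexive (sym eq)))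
... | r , l = exchange-connected (P ∘ (inside ∷_)) (λ l l′ → ex (skip l) (skip l′)) r q
  (suc-injective (trans (⋖-card l) eq)) (ex (skip l) add h)

-- fill e A is the complement of e together with A, where A is read as a subset of e.
fill : (e : Subset n) → Subset ∣ e ∣ → Subset n
fill []          A       = []
fill (true  ∷ e) (b ∷ A) = b ∷ fill e A
fill (false ∷ e) A       = inside ∷ fill e A

fill-card : (e : Subset n) (A : Subset ∣ e ∣) → ∣ fill e A ∣ + ∣ e ∣ ≡ ∣ A ∣ + n
fill-card []          []          = refl
fill-card (true  ∷ e) (true  ∷ A) =
  cong suc (trans (+-suc _ _) (trans (cong suc (fill-card e A)) (sym (+-suc _ _))))
fill-card (true  ∷ e) (false ∷ A) = trans (+-suc _ _) (trans (cong suc (fill-card e A)) (sym (+-suc _ _)))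
fill-card (false ∷ e) A           = trans (cong suc (fill-card e A)) (sym (+-suc _ _))

fill-injective : (e : Subset n) {A B : Subset ∣ e ∣} → fill e A ≡ fill e B → A ≡ B
fill-injective []          {[]}    {[]}    _  = refl
fill-injective (true  ∷ e) {_ ∷ _} {_ ∷ _} eq =
  cong₂ _∷_ (∷-injectiveˡ eq) (fill-injective e (∷-injectiveʳ eq))
fill-injective (false ∷ e) eq = fill-injective e (∷-injectiveʳ eq)

fill-⋖ : (e : Subset n) {A B : Subset ∣ e ∣} → A ⋖ B → fill e A ⋖ fill e B
fill-⋖ (true  ∷ e) add      = add
fill-⋖ (true  ∷ e) (skip l) = skip (fill-⋖ e l)
fill-⋖ (false ∷ e) l        = skip (fill-⋖ e l)

-- The elements of `e` are numbered in increasing order, so moves downwards are preserved. This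
-- makes links stable.
fill-⊲ : (e : Subset n) {A B : Subset ∣ e ∣} → A ⊲ B → fill e A ⊲ fill e B
fill-⊲ (true  ∷ e) (move l) = move (fill-⋖ e l)
fill-⊲ (true  ∷ e) (skip l) = skip (fill-⊲ e l)
fill-⊲ (false ∷ e) l        = skip (fill-⊲ e l)

fill-∈ : {e : Subset n} {x : Fin n} → x ∈ e → ∃ λ y → ∀ A → x ∈ fill e A → y ∈ A
fill-∈ {e = true ∷ e} here = zero , λ where (_ ∷ _) here → here
fill-∈ {e = true ∷ e} (there x∈e) with fill-∈ x∈e
... | y , h = suc y , λ where (_ ∷ A) (there x∈) → there (h A x∈)
fill-∈ {e = false ∷ e} (there x∈e) with fill-∈ x∈e
... | y , h = y , λ where A (there x∈) → h A x∈

-- Tests whether `p ∪ q` is everything, that is `∁ p ⊆ q`. The symmetric form lets the double count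
-- read a pair from either side.
covers : Subset n → Subset n → Bool
covers []      []      = true
covers (x ∷ p) (y ∷ q) = (x ∨ y) ∧ covers p q

covers-comm : (p q : Subset n) → covers p q ≡ covers q p
covers-comm []      []      = refl
covers-comm (x ∷ p) (y ∷ q) = cong₂ _∧_ (Bool.∨-comm x y) (covers-comm p q)

covers⁺ : {p q : Subset n} → ∁ p ⊆ q → covers p q ≡ true
covers⁺ {p = []}        {[]}        _ = refl
covers⁺ {p = true  ∷ p} {_ ∷ q}     h = covers⁺ {p = p} (drop-∷-⊆ h)
covers⁺ {p = false ∷ p} {true  ∷ q} h = covers⁺ {p = p} (drop-∷-⊆ h)
covers⁺ {p = false ∷ p} {false ∷ q} h with () ← h here

covers⁻ : ∀ {p q : Subset n} x → covers p q ≡ true → x ∈ p ⊎ x ∈ q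
covers⁻ {p = true  ∷ p} {_ ∷ q}     zero    _ = inj₁ here
covers⁻ {p = false ∷ p} {true  ∷ q} zero    _ = inj₂ here
covers⁻ {p = b ∷ p}     {b′ ∷ q}    (suc x) h with true ← b ∨ b′ with covers⁻ {p = p} x h
... | inj₁ x∈p = inj₁ (there x∈p)
... | inj₂ x∈q = inj₂ (there x∈q)

covers-⋖ : p ⋖ q → covers p r ≡ true → covers q r ≡ true
covers-⋖ {r = true ∷ r} add h = h
covers-⋖ {r = b ∷ r} (skip {b = b′} l) h with b′ ∨ b
... | true = covers-⋖ {r = r} l h

∑-covers : (e : Subset n) (u : Subset n → ℕ) →
  ∑ (λ a → 𝟙 (covers e a) * u a) ≡ ∑ (λ A → u (fill e A))
∑-covers []          u = +-identityʳ _
∑-covers (true  ∷ e) u = cong₂ _+_ (∑-covers e (u ∘ (inside ∷_))) (∑-covers e (u ∘ (outside ∷_)))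
∑-covers {suc n} (false ∷ e) u =
  trans (cong₂ _+_ (∑-covers e (u ∘ (inside ∷_))) (∑-0 {n})) (+-identityʳ _)

-- Admissible families, where c = d - 1

record Admissible (c k : ℕ) (f : Subset n → Bool) : Set where
  field
    stable  : p ⊲ q → f q ≡ true → f p ≡ true
    uniform : UniformFor k f
    -- With `d = c + 1` the size condition is `|U| ≤ 2k - (d - 2)` without truncated subtraction, so
    -- `d = 1` makes sense too. Any `U` containing the sets may stand in for their union.
    meet    : (A : Fin (suc c) → Subset n) → Injective _≡_ _≡_ A → (∀ i → f (A i) ≡ true) →
              (U : Subset n) → (∀ i → A i ⊆ U) → ∣ U ∣ + c ≤ suc (2 * k) →
              ∃ λ x → ∀ i → x ∈ A i

open Admissible

-- Appending a last element

∣∷ʳ∣-in : (p : Subset n) → ∣ p ∷ʳ inside ∣ ≡ suc ∣ p ∣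
∣∷ʳ∣-in []          = refl
∣∷ʳ∣-in (true  ∷ p) = cong suc (∣∷ʳ∣-in p)
∣∷ʳ∣-in (false ∷ p) = ∣∷ʳ∣-in p

∣∷ʳ∣-out : (p : Subset n) → ∣ p ∷ʳ outside ∣ ≡ ∣ p ∣
∣∷ʳ∣-out []          = refl
∣∷ʳ∣-out (true  ∷ p) = cong suc (∣∷ʳ∣-out p)
∣∷ʳ∣-out (false ∷ p) = ∣∷ʳ∣-out p

∷ʳ-∈⁺ : ∀ {b x} → x ∈ p → inject₁ x ∈ p ∷ʳ b
∷ʳ-∈⁺ here        = here
∷ʳ-∈⁺ (there x∈p) = there (∷ʳ-∈⁺ x∈p)

∷ʳ-∈⁻ : ∀ {b x} {p : Subset n} → inject₁ x ∈ p ∷ʳ b → x ∈ p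
∷ʳ-∈⁻ {x = zero}  {_ ∷ p} here        = here
∷ʳ-∈⁻ {x = suc x} {_ ∷ p} (there x∈p) = there (∷ʳ-∈⁻ x∈p)

last∈ : (p : Subset n) → fromℕ n ∈ p ∷ʳ inside
last∈ []      = here
last∈ (_ ∷ p) = there (last∈ p)

last∉ : (p : Subset n) → fromℕ n ∉ p ∷ʳ outside
last∉ (_ ∷ p) (there x∈p) = last∉ p x∈p

∷ʳ-⊆ : ∀ {b} {p q : Subset n} → p ⊆ q → p ∷ʳ b ⊆ q ∷ʳ inside
∷ʳ-⊆ {q = q} p⊆q {x} x∈ with view x
... | ‵fromℕ    = last∈ q
... | ‵inject₁ y = ∷ʳ-∈⁺ (p⊆q (∷ʳ-∈⁻ x∈))

∷ʳ-⊆-out : {p q : Subset n} → p ⊆ q → p ∷ʳ outside ⊆ q ∷ʳ outside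
∷ʳ-⊆-out {p = p} p⊆q {x} x∈ with view x
... | ‵fromℕ    = ⊥-elim (last∉ p x∈)
... | ‵inject₁ y = ∷ʳ-∈⁺ (p⊆q (∷ʳ-∈⁻ x∈))

-- The sets are added one by one to their union `V`. The next set either meets `V`, and the point
-- met is traced back to one of the sets in it, or contributes `s` new elements.
disjoint-or-collision : ∀ {d s} (B : Fin d → Subset n) → (∀ i → ∣ B i ∣ ≡ s) →
  (∃₂ λ i j → i ≢ j × Nonempty (B i ∩ B j)) ⊎
  (∃ λ V → (∀ {x} → x ∈ V → ∃ λ i → x ∈ B i) × d * s ≤ ∣ V ∣)
disjoint-or-collision {d = zero} B size = inj₂ (⊥ , (λ x∈⊥ → ⊥-elim (∉⊥ x∈⊥)) , z≤n)
disjoint-or-collision {d = suc d} {s} B size with disjoint-or-collision (B ∘ suc) (size ∘ suc)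
... | inj₁ (i , j , i≢j , ne) = inj₁ (suc i , suc j , i≢j ∘ Fin.suc-injective , ne)
... | inj₂ (V , V⊆ , le) with nonempty? (B zero ∩ V)
...   | yes (x , x∈) with V⊆ (proj₂ (x∈p∩q⁻ (B zero) V x∈))
...     | i , x∈Bi = inj₁ (zero , suc i , (λ ()) , x , x∈p∩q⁺ (proj₁ (x∈p∩q⁻ (B zero) V x∈) , x∈Bi))
disjoint-or-collision {n} {suc d} {s} B size | inj₂ (V , V⊆ , le) | no empty =
  inj₂ (B zero ∪ V , ∪⊆ , (begin
    s + d * s                          ≤⟨ +-monoʳ-≤ s le ⟩
    s + ∣ V ∣                          ≡⟨ cong (_+ ∣ V ∣) (size zero) ⟨
    ∣ B zero ∣ + ∣ V ∣                 ≡⟨ ∣∪∣+∣∩∣ (B zero) V ⟨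
    ∣ B zero ∪ V ∣ + ∣ B zero ∩ V ∣    ≡⟨ cong (λ W → ∣ B zero ∪ V ∣ + ∣ W ∣) (Empty-unique empty) ⟩
    ∣ B zero ∪ V ∣ + ∣ ⊥ {n} ∣         ≡⟨ cong (∣ B zero ∪ V ∣ +_) (∣⊥∣≡0 n) ⟩
    ∣ B zero ∪ V ∣ + 0                 ≡⟨ +-identityʳ _ ⟩
    ∣ B zero ∪ V ∣                     ∎))
  where
  open ≤-Reasoning
  ∪⊆ : ∀ {x} → x ∈ B zero ∪ V → ∃ λ i → x ∈ B i
  ∪⊆ x∈ with x∈p∪q⁻ (B zero) V x∈
  ... | inj₁ x∈B = zero , x∈B
  ... | inj₂ x∈V with V⊆ x∈V
  ...   | i , x∈B = suc i , x∈B

collision : ∀ {d s} (B : Fin d → Subset n) → (∀ i → ∣ B i ∣ ≡ s) → n < d * s →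
  ∃₂ λ i j → i ≢ j × Nonempty (B i ∩ B j)
collision B size n<ds with disjoint-or-collision B size
... | inj₁ found         = found
... | inj₂ (V , _ , le) = contradiction (≤-trans n<ds (≤-trans le (∣p∣≤n V))) (<-irrefl refl)

-- Splitting by the last element

last-out : {f : Subset (suc n) → Bool} → Admissible c k f →
  Admissible c k (λ A → f (A ∷ʳ outside))
last-out adm .stable l h = adm .stable (∷ʳ-⊲ l) h
last-out adm .uniform {A} h = trans (sym (∣∷ʳ∣-out A)) (adm .uniform h)
last-out {c = c} {k} {f} adm .meet A inj A∈ U A⊆U size
  with adm .meet (λ i → A i ∷ʳ outside) (λ eq → inj (∷ʳ-injectiveˡ _ _ eq)) A∈ (U ∷ʳ outside)
         (λ i → ∷ʳ-⊆-out (A⊆U i)) (subst (λ z → z + c ≤ suc (2 * k)) (sym (∣∷ʳ∣-out U)) size)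
... | x , x∈ with view x
...   | ‵fromℕ    = ⊥-elim (last∉ (A zero) (x∈ zero))
...   | ‵inject₁ y = y , λ i → ∷ʳ-∈⁻ (x∈ i)

-- Some x is missing from two of the sets, A i and A j. Replacing the last
-- element by x in A i ∪ {last} leaves neither x nor the last element common.
last-in : ∀ {s} {f : Subset (suc n) → Bool} → n ≡ k + suc s → suc k ≤ c * suc s →
  Admissible c (suc k) f → Admissible c k (λ A → f (A ∷ʳ inside))
last-in _ _ adm .stable l h = adm .stable (∷ʳ-⊲ l) h
last-in _ _ adm .uniform {A} h = suc-injective (trans (sym (∣∷ʳ∣-in A)) (adm .uniform h))
last-in {n} {k} {c} {s} {f} n≡ k<cs adm .meet A inj A∈ U A⊆U size
  with collision (∁ ∘ A) ∁size n<
  where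
  ∁size : ∀ i → ∣ ∁ (A i) ∣ ≡ suc s
  ∁size i = +-cancelʳ-≡ ∣ A i ∣ _ _ (begin
    ∣ ∁ (A i) ∣ + ∣ A i ∣   ≡⟨ ∣∁p∣+∣p∣≡n (A i) ⟩
    n                       ≡⟨ n≡ ⟩
    k + suc s               ≡⟨ +-comm k (suc s) ⟩
    suc s + k               ≡⟨ cong (suc s +_) (last-in n≡ k<cs adm .uniform (A∈ i)) ⟨
    suc s + ∣ A i ∣         ∎)
    where open ≡-Reasoning
  n< : n < suc c * suc s
  n< = begin-strict
    n                    ≡⟨ n≡ ⟩
    k + suc s            <⟨ +-monoˡ-< (suc s) k<cs ⟩
    c * suc s + suc s    ≡⟨ +-comm (c * suc s) (suc s) ⟩
    suc c * suc s        ∎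
    where open ≤-Reasoning
... | i , j , i≢j , x , x∈∁∁ = common (view (proj₁ hit)) (proj₂ hit)
  where
  x∉Ai : x ∉ A i
  x∉Ai = x∈∁p⇒x∉p (proj₁ (x∈p∩q⁻ (∁ (A i)) (∁ (A j)) x∈∁∁))
  moved : ∀ l → Dec (l ≡ i) → Subset (suc n)
  moved l (yes _) = (A l ∪ ⁅ x ⁆) ∷ʳ outside
  moved l (no _)  = A l ∷ʳ inside
  A′ : Fin (suc c) → Subset (suc n)
  A′ l = moved l (l Fin.≟ i)
  A′-injective : Injective _≡_ _≡_ A′
  A′-injective {l} {l′} eq with l Fin.≟ i | l′ Fin.≟ i
  ... | yes refl | yes refl = refl
  ... | yes _    | no _     = contradiction (∷ʳ-injectiveʳ (A l ∪ ⁅ x ⁆) (A l′) eq) λ ()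
  ... | no _     | yes _    = contradiction (∷ʳ-injectiveʳ (A l) (A l′ ∪ ⁅ x ⁆) eq) λ ()
  ... | no _     | no _     = inj (∷ʳ-injectiveˡ _ _ eq)
  A′∈ : ∀ l → f (A′ l) ≡ true
  A′∈ l with l Fin.≟ i
  ... | yes refl = adm .stable (⋖⇒∷ʳ-⊲ (p⋖p∪x x∉Ai)) (A∈ i)
  ... | no _     = A∈ l
  A′⊆ : ∀ l → A′ l ⊆ (U ∪ ⁅ x ⁆) ∷ʳ inside
  A′⊆ l with l Fin.≟ i
  ... | yes _ = ∷ʳ-⊆ λ z∈ → x∈p∪q⁺ (Sum.map₁ (A⊆U l) (x∈p∪q⁻ (A l) ⁅ x ⁆ z∈))
  ... | no _  = ∷ʳ-⊆ λ z∈ → x∈p∪q⁺ (inj₁ (A⊆U l z∈))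
  -- `x` and the last element enlarge `U` by at most two, which is what passing from `k` to `suc k`
  -- allows.
  size′ : ∣ (U ∪ ⁅ x ⁆) ∷ʳ inside ∣ + c ≤ suc (2 * suc k)
  size′ = begin
    ∣ (U ∪ ⁅ x ⁆) ∷ʳ inside ∣ + c   ≡⟨ cong (_+ c) (∣∷ʳ∣-in (U ∪ ⁅ x ⁆)) ⟩
    suc ∣ U ∪ ⁅ x ⁆ ∣ + c           ≤⟨ s≤s (+-monoˡ-≤ c (∣p∪q∣≤∣p∣+∣q∣ U ⁅ x ⁆)) ⟩
    suc (∣ U ∣ + ∣ ⁅ x ⁆ ∣ + c)     ≡⟨ cong (λ z → suc (∣ U ∣ + z + c)) (∣⁅x⁆∣≡1 x) ⟩
    suc (∣ U ∣ + 1 + c)             ≡⟨ cong (λ z → suc (z + c)) (+-comm ∣ U ∣ 1) ⟩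
    2 + (∣ U ∣ + c)                 ≤⟨ +-monoʳ-≤ 2 size ⟩
    2 + suc (2 * k)                 ≡⟨ cong suc (*-suc 2 k) ⟨
    suc (2 * suc k)                 ∎
    where open ≤-Reasoning
  hit : ∃ λ z → ∀ l → z ∈ A′ l
  hit = adm .meet A′ (λ {l} {l′} → A′-injective {l} {l′}) A′∈ ((U ∪ ⁅ x ⁆) ∷ʳ inside) A′⊆ size′
  x∉Aj : x ∉ A j
  x∉Aj = x∈∁p⇒x∉p (proj₂ (x∈p∩q⁻ (∁ (A i)) (∁ (A j)) x∈∁∁))
  A′-i : A′ i ≡ (A i ∪ ⁅ x ⁆) ∷ʳ outside
  A′-i with i Fin.≟ i
  ... | yes _  = refl
  ... | no i≢i = contradiction refl i≢i
  A′-≢ : ∀ {l} → l ≢ i → A′ l ≡ A l ∷ʳ inside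
  A′-≢ {l} l≢i with l Fin.≟ i
  ... | yes l≡i = contradiction l≡i l≢i
  ... | no _    = refl
  -- The common element is not the last one, which `A′ i` lacks, and not `x`, which `A j` lacks; any
  -- other one in `A′ i` lies in `A i`.
  common : ∀ {z} → View z → (∀ l → z ∈ A′ l) → ∃ λ y → ∀ l → y ∈ A l
  common ‵fromℕ        z∈ = ⊥-elim (last∉ (A i ∪ ⁅ x ⁆) (subst (_ ∈_) A′-i (z∈ i)))
  common (‵inject₁ y)  z∈ = y , y∈
    where
    y∈-≢ : ∀ {l} → l ≢ i → y ∈ A l
    y∈-≢ {l} l≢i = ∷ʳ-∈⁻ (subst (_ ∈_) (A′-≢ {l} l≢i) (z∈ l))
    y∈ : ∀ l → y ∈ A l
    y∈ l with l Fin.≟ i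
    ... | no l≢i = y∈-≢ l≢i
    ... | yes refl with x∈p∪q⁻ (A i) ⁅ x ⁆ (∷ʳ-∈⁻ (subst (_ ∈_) A′-i (z∈ i)))
    ...   | inj₁ y∈Ai = y∈Ai
    ...   | inj₂ y∈x  =
      ⊥-elim (x∉Aj (subst (_∈ A j) (x∈⁅y⁆⇒x≡y x y∈x) (y∈-≢ (i≢j ∘ sym))))

-- Links of members avoiding 0

link : (f : Subset (suc n) → Bool) (e : Subset n) → Subset ∣ e ∣ → Bool
link f e A = f (inside ∷ fill e A)

fill-size : (e : Subset n) (A : Subset ∣ e ∣) → ∀ {i j} → i + n ≡ j + ∣ e ∣ →
  (∣ fill e A ∣ ≡ᵇ j) ≡ (∣ A ∣ ≡ᵇ i)
fill-size {n} e A {i} {j} eq = ≡ᵇ-⇔ {∣ fill e A ∣} {j} {∣ A ∣} {i}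
  (λ { refl → +-cancelʳ-≡ n _ _ (trans (sym (fill-card e A)) (sym eq)) })
  (λ { refl → +-cancelʳ-≡ ∣ e ∣ _ _ (trans (fill-card e A) eq) })

-- The filled sets with 0 added, together with `outside ∷ e`, are `c + 2` distinct members. Their
-- common element lies in `e`, hence pulls back to the link. The second hypothesis lets the whole
-- ground set serve as `U`.
link-admissible : ∀ {k′} {f : Subset (suc n) → Bool} {e} → k′ + suc n ≡ k + k → suc n + suc c ≤ suc (2 * k) →
  f (outside ∷ e) ≡ true → Admissible (suc c) k f → Admissible c k′ (link f e)
link-admissible {e = e} _ _ _ adm .stable l h = adm .stable (skip (fill-⊲ e l)) h
link-admissible {n} {k} {k′ = k′} {e = e} k′≡ _ e∈ adm .uniform {A} h = +-cancelʳ-≡ (suc n) _ _ (begin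
  ∣ A ∣ + suc n               ≡⟨ +-suc ∣ A ∣ n ⟩
  suc (∣ A ∣ + n)             ≡⟨ cong suc (fill-card e A) ⟨
  suc ∣ fill e A ∣ + ∣ e ∣    ≡⟨ cong₂ _+_ (adm .uniform h) (adm .uniform e∈) ⟩
  k + k                       ≡⟨ k′≡ ⟨
  k′ + suc n                  ∎)
  where open ≡-Reasoning
link-admissible {n} {k} {c} {f = f} {e} _ size e∈ adm .meet A inj A∈ _ _ _
  with adm .meet A′ A′-injective A′∈ ⊤ (λ _ → ⊆⊤) (subst (λ z → z + suc c ≤ suc (2 * k)) (sym (∣⊤∣≡n (suc n))) size)
  where
  A′ : Fin (suc (suc c)) → Subset (suc n)
  A′ zero    = outside ∷ e
  A′ (suc i) = inside ∷ fill e (A i)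
  A′-injective : Injective _≡_ _≡_ A′
  A′-injective {zero}  {zero}  _  = refl
  A′-injective {suc i} {suc j} eq = cong suc (inj (fill-injective e (∷-injectiveʳ eq)))
  A′∈ : ∀ i → f (A′ i) ≡ true
  A′∈ zero    = e∈
  A′∈ (suc i) = A∈ i
... | x , x∈ with x∈ zero
...   | there x∈e with fill-∈ x∈e
...     | y , h = y , λ i → h (A i) (drop-there (x∈ (suc i)))

-- The extreme case `k = c`

removal : (e : Subset n) → Fin ∣ e ∣ → Subset n
removal (true  ∷ e) zero    = outside ∷ e
removal (true  ∷ e) (suc i) = inside ∷ removal e i
removal (false ∷ e) i       = outside ∷ removal e i

removal-⋖ : (e : Subset n) → ∀ i → removal e i ⋖ e
removal-⋖ (true  ∷ e) zero    = add
removal-⋖ (true  ∷ e) (suc i) = skip (removal-⋖ e i)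
removal-⋖ (false ∷ e) i       = skip (removal-⋖ e i)

removal-injective : (e : Subset n) → Injective _≡_ _≡_ (removal e)
removal-injective (true  ∷ e) {zero}  {zero}  _  = refl
removal-injective (true  ∷ e) {suc i} {suc j} eq = cong suc (removal-injective e (∷-injectiveʳ eq))
removal-injective (false ∷ e) eq = removal-injective e (∷-injectiveʳ eq)

removal-∉ : ∀ {e : Subset n} {x} → x ∈ e → ∃ λ i → x ∉ removal e i
removal-∉ {e = true  ∷ e} here = zero , λ ()
removal-∉ {e = true  ∷ e} (there x∈e) with removal-∉ x∈e
... | i , x∉ = suc i , x∉ ∘ drop-there
removal-∉ {e = false ∷ e} (there x∈e) with removal-∉ x∈e
... | i , x∉ = i , x∉ ∘ drop-there

⋖⇒⊆ : p ⋖ q → p ⊆ q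
⋖⇒⊆ add      = out⊆ (λ x∈ → x∈)
⋖⇒⊆ (skip l) = s⊆s (⋖⇒⊆ l)

-- All k-subsets of {0} ∪ e lie in the family, and they have no common element.
tight-avoids-0 : {f : Subset (suc n) → Bool} → Admissible k k f → ∀ e → f (outside ∷ e) ≡ false
tight-avoids-0 {f = f} adm e with f (outside ∷ e) in e∈
... | false = refl
... | true with refl ← adm .uniform e∈
  with adm .meet A A-injective A∈ (inside ∷ e) A⊆ size
  where
  A : Fin (suc ∣ e ∣) → Subset _
  A zero    = outside ∷ e
  A (suc i) = inside ∷ removal e i
  A-injective : Injective _≡_ _≡_ A
  A-injective {zero}  {zero}  _  = refl
  A-injective {suc i} {suc j} eq = cong suc (removal-injective e (∷-injectiveʳ eq))
  A∈ : ∀ i → f (A i) ≡ true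
  A∈ zero    = e∈
  A∈ (suc i) = adm .stable (move (removal-⋖ e i)) e∈
  A⊆ : ∀ i → A i ⊆ inside ∷ e
  A⊆ zero    = out⊆ (λ x∈ → x∈)
  A⊆ (suc i) = s⊆s (⋖⇒⊆ (removal-⋖ e i))
  -- `{0} ∪ e` has `k + 1` elements and `c = k`, so the size condition holds with equality.
  size : suc ∣ e ∣ + ∣ e ∣ ≤ suc (2 * ∣ e ∣)
  size = ≤-reflexive (cong (λ z → suc (∣ e ∣ + z)) (sym (+-identityʳ ∣ e ∣)))
...   | x , x∈ with x∈ zero
...     | there x∈e with removal-∉ x∈e
...       | i , x∉ = ⊥-elim (x∉ (drop-there (x∈ (suc i))))

-- The bound and the double count

Bound : ℕ → ℕ → (Subset (suc m) → Bool) → Set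
Bound {m} c k f =
  layer m k ≤ #missing k f ×
  -- `2 ≤ c` is `d ≥ 3`. This half passes through the induction as well: `split-last` draws it from
  -- the part without the last element.
  (2 ≤ c → ∀ {e} → f (outside ∷ e) ≡ true → layer m k < #missing k f)

avoiding-0 : ∀ {f : Subset (suc m) → Bool} → (∀ e → f (outside ∷ e) ≡ false) →
  layer m k ≡ #missing k (f ∘ (outside ∷_))
avoiding-0 {k = k} avoids = ∑-cong λ e → cong 𝟙
  (sym (trans (cong (λ b → (∣ e ∣ ≡ᵇ k) ∧ not b) (avoids e)) (Bool.∧-identityʳ _)))

-- Every a ⊇ ∁ e is fill e A for a unique A, so the pairs e ∈ F, a ∪ {0} ∉ F
-- with e ∪ a everything are counted from e by the links of the family.
module Boundary
  (c k′ s k₁ ground : ℕ) (k₁≡ : k₁ ≡ k′ + s) (ground≡ : ground ≡ suc k₁ + s)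
  (f : Subset (suc ground) → Bool) (adm : Admissible c (suc k₁) f)
  (links : ∀ e → f (outside ∷ e) ≡ true → layer k₁ k′ ≤ #missing k′ (link f e))
  where

  -- The degree in the double count: each present `e` is covered by at least `D` absent sets, and
  -- each absent `a` by exactly `D` sets of size `suc k₁`.
  D : ℕ
  D = layer k₁ k′

  absent : Subset ground → Bool
  absent = missing k₁ (f ∘ (inside ∷_))

  present : Subset ground → Bool
  present e = f (outside ∷ e)

  present-size : ∀ {e} → present e ≡ true → ∣ e ∣ ≡ suc k₁
  present-size = adm .uniform

  k′+ground : ∀ {j} → j ≡ suc k₁ → k′ + ground ≡ k₁ + j
  k′+ground refl = begin
    k′ + ground         ≡⟨ cong (k′ +_) (trans ground≡ (+-comm (suc k₁) s)) ⟩
    k′ + (s + suc k₁)   ≡⟨ +-assoc k′ s (suc k₁) ⟨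
    k′ + s + suc k₁     ≡⟨ cong (_+ suc k₁) k₁≡ ⟨
    k₁ + suc k₁         ∎
    where open ≡-Reasoning

  -- Under `∑-covers`, the `k′`-sets missing from the link of `e` become the absent sets covering
  -- `e`.
  absent-cover : ∀ {e} → present e ≡ true → D ≤ ∑ (λ a → 𝟙 (covers e a) * 𝟙 (absent a))
  absent-cover {e} e∈ = ≤-trans (links e e∈) (≤-reflexive (sym (trans
    (∑-covers e (𝟙 ∘ absent))
    (∑-cong λ A → cong (λ b → 𝟙 (b ∧ not (link f e A))) (fill-size e A (k′+ground (present-size e∈)))))))

  cover-count : ∀ {a} → ∣ a ∣ ≡ k₁ → ∑ (λ e → 𝟙 (covers a e) * 𝟙 (∣ e ∣ ≡ᵇ suc k₁)) ≡ D
  cover-count {a} size = begin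
    ∑ (λ e → 𝟙 (covers a e) * 𝟙 (∣ e ∣ ≡ᵇ suc k₁))   ≡⟨ ∑-covers a (λ e → 𝟙 (∣ e ∣ ≡ᵇ suc k₁)) ⟩
    ∑ (λ A → 𝟙 (∣ fill a A ∣ ≡ᵇ suc k₁))             ≡⟨ ∑-cong (λ A → cong 𝟙 (fill-size a A eq)) ⟩
    layer ∣ a ∣ k′                                    ≡⟨ cong (λ n → layer n k′) size ⟩
    D                                                 ∎
    where
    open ≡-Reasoning
    eq : k′ + ground ≡ suc k₁ + ∣ a ∣
    eq rewrite size = trans (k′+ground refl) (+-suc k₁ k₁)

  pairs : Subset ground → Subset ground → ℕ
  pairs a e = 𝟙 (absent a) * (𝟙 (covers a e) * 𝟙 (present e))

  all-pairs : Subset ground → Subset ground → ℕ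
  all-pairs a e = 𝟙 (absent a) * (𝟙 (covers a e) * 𝟙 (∣ e ∣ ≡ᵇ suc k₁))

  pairs≤all-pairs : ∀ a e → pairs a e ≤ all-pairs a e
  pairs≤all-pairs a e = *-monoʳ-≤ (𝟙 (absent a)) (*-monoʳ-≤ (𝟙 (covers a e)) le)
    where
    le : 𝟙 (present e) ≤ 𝟙 (∣ e ∣ ≡ᵇ suc k₁)
    le with present e in e∈
    ... | false = z≤n
    ... | true rewrite ≡ᵇ-true (present-size e∈) = ≤-refl

  pairs-lower : ∑ (𝟙 ∘ present) * D ≤ ∑ (λ a → ∑ (pairs a))
  pairs-lower = begin
    ∑ (𝟙 ∘ present) * D                ≡⟨ ∑-*ʳ D (𝟙 ∘ present) ⟨
    ∑ (λ e → 𝟙 (present e) * D)        ≤⟨ ∑-mono le ⟩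
    ∑ (λ e → ∑ (λ a → pairs a e))      ≡⟨ ∑-swap (λ e a → pairs a e) ⟩
    ∑ (λ a → ∑ (pairs a))              ∎
    where
    open ≤-Reasoning
    le : ∀ e → 𝟙 (present e) * D ≤ ∑ (λ a → pairs a e)
    le e with present e in e∈
    ... | false = z≤n
    ... | true = begin
      D + 0                                              ≡⟨ +-identityʳ D ⟩
      D                                                  ≤⟨ absent-cover e∈ ⟩
      ∑ (λ a → 𝟙 (covers e a) * 𝟙 (absent a))
        ≡⟨ ∑-cong (λ a → cong (λ b → 𝟙 b * 𝟙 (absent a)) (covers-comm e a)) ⟩
      ∑ (λ a → 𝟙 (covers a e) * 𝟙 (absent a))            ≡⟨ ∑-cong (λ a → *-comm (𝟙 (covers a e)) _) ⟩
      ∑ (λ a → 𝟙 (absent a) * 𝟙 (covers a e))            ≡⟨ ∑-cong (λ a → cong (𝟙 (absent a) *_) (*-identityʳ _)) ⟨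
      ∑ (λ a → 𝟙 (absent a) * (𝟙 (covers a e) * 1))      ∎

  all-pairs-total : ∑ (λ a → ∑ (all-pairs a)) ≡ ∑ (𝟙 ∘ absent) * D
  all-pairs-total = trans (∑-cong eq) (∑-*ʳ D (𝟙 ∘ absent))
    where
    eq : ∀ a → ∑ (all-pairs a) ≡ 𝟙 (absent a) * D
    eq a = trans (∑-*ˡ (𝟙 (absent a)) (λ e → 𝟙 (covers a e) * 𝟙 (∣ e ∣ ≡ᵇ suc k₁))) eq′
      where
      eq′ : 𝟙 (absent a) * ∑ (λ e → 𝟙 (covers a e) * 𝟙 (∣ e ∣ ≡ᵇ suc k₁)) ≡ 𝟙 (absent a) * D
      eq′ with absent a in a∉
      ... | false = refl
      ... | true  = cong (_+ 0) (cover-count {a} (proj₁ (missing⁻ (f ∘ (inside ∷_)) {a} a∉)))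

  D-pos : 0 < D
  D-pos rewrite k₁≡ = layer-pos k′ s

  present≤absent : ∑ (𝟙 ∘ present) ≤ ∑ (𝟙 ∘ absent)
  present≤absent = *-cancelʳ-≤ _ _ D {{>-nonZero D-pos}} (begin
    ∑ (𝟙 ∘ present) * D           ≤⟨ pairs-lower ⟩
    ∑ (λ a → ∑ (pairs a))         ≤⟨ ∑-mono (λ a → ∑-mono (pairs≤all-pairs a)) ⟩
    ∑ (λ a → ∑ (all-pairs a))     ≡⟨ all-pairs-total ⟩
    ∑ (𝟙 ∘ absent) * D            ∎)
    where open ≤-Reasoning

  layer≡ : layer ground (suc k₁) ≡ ∑ (𝟙 ∘ present) + #missing (suc k₁) present
  layer≡ = layer-split {f = present} present-size

  bound : layer ground (suc k₁) ≤ #missing (suc k₁) f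
  -- `#missing` splits by definition on 0: sets containing 0 give `absent`, the others
  -- `missing (suc k₁) present`.
  bound = ≤-trans (≤-reflexive layer≡) (+-monoˡ-≤ _ present≤absent)

  -- If equality holds, saturated and absent-avoiding make present closed under
  -- exchanges, hence all or nothing.
  module Tight (s≤k′ : s ≤ k′) (tight : ∑ (𝟙 ∘ absent) ≤ ∑ (𝟙 ∘ present)) where

    pairs≡all-pairs : ∀ a e → pairs a e ≡ all-pairs a e
    -- Equal totals force equal sums for each `a` (inner `∑-tight`), and these force equal terms
    -- (outer one).
    pairs≡all-pairs a = ∑-tight (pairs≤all-pairs a)
      (≤-reflexive (sym (∑-tight (λ a → ∑-mono (pairs≤all-pairs a)) total a)))
      where
      total : ∑ (λ a → ∑ (all-pairs a)) ≤ ∑ (λ a → ∑ (pairs a))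
      total = ≤-trans (≤-reflexive all-pairs-total) (≤-trans (*-monoˡ-≤ D tight) pairs-lower)

    saturated : ∀ {a e} → absent a ≡ true → covers a e ≡ true → ∣ e ∣ ≡ suc k₁ → present e ≡ true
    saturated {a} {e} a∉ cov size = 𝟙-inj eq
      where
      eq : 𝟙 (present e) ≡ 1
      eq with pairs≡all-pairs a e
      ... | h rewrite a∉ | cov | ≡ᵇ-true size = trans (sym (trans (+-identityʳ _) (+-identityʳ _))) h

    -- With x the element of e outside g, the sets a with x ∉ a already account for
    -- all D absent sets that cover e, so each of them is absent. Some e′ ∈ F contains
    -- x and ∁ e, and then e′ - x ∪ {0} ∈ F contradicts this.
    module _ {e g} (e∈ : present e ≡ true) (l : g ⋖ e)
             (none : ¬ (∃ λ a → absent a ≡ true × covers g a ≡ true)) where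

      ∣g∣≡k₁ : ∣ g ∣ ≡ k₁
      ∣g∣≡k₁ = suc-injective (trans (⋖-card l) (present-size e∈))

      -- `upper` counts all `k₁`-sets covering `e`; `lower` counts the absent ones and those
      -- covering `g`, which are the ones containing the element of `e` outside `g`. By `none` these
      -- two kinds are disjoint.
      lower upper : Subset ground → ℕ
      lower a = 𝟙 (covers e a) * 𝟙 (absent a) + 𝟙 (covers g a) * 𝟙 (∣ a ∣ ≡ᵇ k₁)
      upper a = 𝟙 (covers e a) * 𝟙 (∣ a ∣ ≡ᵇ k₁)

      𝟙-∧ : ∀ x y → 𝟙 (x ∧ y) ≤ 𝟙 x
      𝟙-∧ true  true  = ≤-refl
      𝟙-∧ true  false = z≤n
      𝟙-∧ false y     = z≤n

      lower≤upper : ∀ a → lower a ≤ upper a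
      lower≤upper a with covers g a in cov
      ... | false = ≤-trans (≤-reflexive (+-identityʳ _))
        (*-monoʳ-≤ (𝟙 (covers e a)) (𝟙-∧ (∣ a ∣ ≡ᵇ k₁) (not (f (inside ∷ a)))))
      ... | true with absent a in a∉
      ...   | true = contradiction (a , a∉ , cov) none
      ...   | false rewrite covers-⋖ {r = a} l cov = ≤-refl

      -- One element less is free than for `e`. Writing `suc ∣ A ∣` instead of a predecessor of `k′`
      -- includes `k′ = 0`.
      fill-g-size : ∀ A → (∣ fill g A ∣ ≡ᵇ k₁) ≡ (suc ∣ A ∣ ≡ᵇ k′)
      fill-g-size A = ≡ᵇ-⇔ {∣ fill g A ∣} {k₁} {suc ∣ A ∣} {k′}
        (λ eq → +-cancelʳ-≡ ground _ _ (begin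
          suc ∣ A ∣ + ground           ≡⟨ cong suc (fill-card g A) ⟨
          suc (∣ fill g A ∣ + ∣ g ∣)   ≡⟨ cong₂ (λ x y → suc (x + y)) eq ∣g∣≡k₁ ⟩
          suc (k₁ + k₁)                ≡⟨ +-suc k₁ k₁ ⟨
          k₁ + suc k₁                  ≡⟨ k′+ground refl ⟨
          k′ + ground                  ∎))
        (λ eq → +-cancelʳ-≡ ∣ g ∣ _ _ (suc-injective (begin
          suc (∣ fill g A ∣ + ∣ g ∣)   ≡⟨ cong suc (fill-card g A) ⟩
          suc ∣ A ∣ + ground           ≡⟨ cong (_+ ground) eq ⟩
          k′ + ground                  ≡⟨ k′+ground refl ⟩
          k₁ + suc k₁                  ≡⟨ +-suc k₁ k₁ ⟩
          suc (k₁ + k₁)                ≡⟨ cong (λ x → suc (k₁ + x)) ∣g∣≡k₁ ⟨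
          suc (k₁ + ∣ g ∣)             ∎)))
        where open ≡-Reasoning

      upper≤lower : ∑ upper ≤ ∑ lower
      upper≤lower = begin
        ∑ upper
          ≡⟨ ∑-covers e (λ a → 𝟙 (∣ a ∣ ≡ᵇ k₁)) ⟩
        ∑ (λ A → 𝟙 (∣ fill e A ∣ ≡ᵇ k₁))
          ≡⟨ ∑-cong (λ A → cong 𝟙 (fill-size e A (k′+ground (present-size e∈)))) ⟩
        layer ∣ e ∣ k′
          ≡⟨ cong (λ n → layer n k′) (present-size e∈) ⟩
        -- Pascal's rule, by the definition of `∑` on `suc k₁` elements: the subsets without the
        -- first element give `D`.
        ∑ {k₁} (λ A → 𝟙 (suc ∣ A ∣ ≡ᵇ k′)) + D
          ≡⟨ +-comm _ D ⟩
        D + ∑ {k₁} (λ A → 𝟙 (suc ∣ A ∣ ≡ᵇ k′))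
          ≡⟨ cong (λ n → D + ∑ {n} (λ A → 𝟙 (suc ∣ A ∣ ≡ᵇ k′))) ∣g∣≡k₁ ⟨
        D + ∑ {∣ g ∣} (λ A → 𝟙 (suc ∣ A ∣ ≡ᵇ k′))
          ≡⟨ cong (D +_) (∑-cong (λ A → cong 𝟙 (fill-g-size A))) ⟨
        D + ∑ (λ A → 𝟙 (∣ fill g A ∣ ≡ᵇ k₁))
          ≡⟨ cong (D +_) (∑-covers g (λ a → 𝟙 (∣ a ∣ ≡ᵇ k₁))) ⟨
        D + ∑ (λ a → 𝟙 (covers g a) * 𝟙 (∣ a ∣ ≡ᵇ k₁))
          ≤⟨ +-monoˡ-≤ _ (absent-cover e∈) ⟩
        ∑ (λ a → 𝟙 (covers e a) * 𝟙 (absent a)) + ∑ (λ a → 𝟙 (covers g a) * 𝟙 (∣ a ∣ ≡ᵇ k₁))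
          ≡⟨ ∑-+ (λ a → 𝟙 (covers e a) * 𝟙 (absent a)) (λ a → 𝟙 (covers g a) * 𝟙 (∣ a ∣ ≡ᵇ k₁)) ⟨
        ∑ lower
          ∎
        where open ≤-Reasoning

      star-absent : ∀ {a} → ∣ a ∣ ≡ k₁ → covers e a ≡ true → covers g a ≡ false → absent a ≡ true
      star-absent {a} size cov-e cov-g with ∑-tight lower≤upper upper≤lower a
      ... | h rewrite cov-e | cov-g | ≡ᵇ-true size = 𝟙-inj (trans (sym (trans (+-identityʳ _) (+-identityʳ _))) h)

      x : Fin ground
      x = added l

      x∈e : x ∈ e
      x∈e = added∈ l

      not-covers : ∀ {a} → x ∉ a → covers g a ≡ false
      not-covers {a} x∉a with covers g a in cov
      ... | false = refl
      ... | true with covers⁻ {p = g} x cov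
      ...   | inj₁ x∈g = contradiction x∈g (added∉ l)
      ...   | inj₂ x∈a = contradiction x∈a x∉a

      ∣∁∣ : ∀ (p : Subset ground) {i j} → ∣ p ∣ ≡ i → i + j ≡ ground → ∣ ∁ p ∣ ≡ j
      ∣∁∣ p {i} {j} refl eq = +-cancelʳ-≡ ∣ p ∣ _ _ (trans (∣∁p∣+∣p∣≡n p) (trans (sym eq) (+-comm i j)))

      s≤k₁ : s ≤ k₁
      s≤k₁ = ≤-trans (m≤n+m s k′) (≤-reflexive (sym k₁≡))

      ∣∁e∣≡s : ∣ ∁ e ∣ ≡ s
      ∣∁e∣≡s = ∣∁∣ e (present-size e∈) (sym ground≡)

      star-contradiction : Empty.⊥
      star-contradiction
        with between {p = ∁ e} {∁ ⁅ x ⁆} (p⊆q⇒∁p⊇∁q λ y∈ → subst (_∈ e) (sym (x∈⁅y⁆⇒x≡y x y∈)) x∈e)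
               k₁ (≤-trans (≤-reflexive ∣∁e∣≡s) s≤k₁)
               (≤-trans (m≤m+n k₁ s) (≤-reflexive (sym (∣∁∣ ⁅ x ⁆ (∣⁅x⁆∣≡1 x) (sym ground≡)))))
      ... | a , ∁e⊆a , a⊆∁x , ∣a∣ = contra
        where
        x∉a : x ∉ a
        x∉a x∈a = x∈∁p⇒x∉p (a⊆∁x x∈a) (x∈⁅x⁆ x)
        a∉ : absent a ≡ true
        a∉ = star-absent ∣a∣ (covers⁺ {p = e} ∁e⊆a) (not-covers x∉a)
        contra : Empty.⊥
        -- `e′ ⊇ ∁ a` contains `x` and is present by `saturated`; `e′ ⊇ ∁ e` ensures that `e′ - x`
        -- still covers `e`.
        contra with between {p = ∁ e ∪ ∁ a} {⊤} ⊆⊤ (suc k₁) size (≤-trans le (≤-reflexive (sym (∣⊤∣≡n ground))))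
          where
          le : suc k₁ ≤ ground
          le = ≤-trans (m≤m+n (suc k₁) s) (≤-reflexive (sym ground≡))
          size : ∣ ∁ e ∪ ∁ a ∣ ≤ suc k₁
          size = begin
            ∣ ∁ e ∪ ∁ a ∣         ≤⟨ ∣p∪q∣≤∣p∣+∣q∣ (∁ e) (∁ a) ⟩
            ∣ ∁ e ∣ + ∣ ∁ a ∣     ≡⟨ cong₂ _+_ ∣∁e∣≡s (∣∁∣ a ∣a∣ (trans (+-suc k₁ s) (sym ground≡))) ⟩
            s + suc s             ≡⟨ +-suc s s ⟩
            -- `s ≤ k′` makes room for both complements in a set of size `suc k₁`.
            suc (s + s)           ≤⟨ s≤s (+-monoˡ-≤ s s≤k′) ⟩
            suc (k′ + s)          ≡⟨ cong suc k₁≡ ⟨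
            suc k₁                ∎
            where open ≤-Reasoning
        ... | e′ , ⊆e′ , _ , ∣e′∣ = contradiction (trans (sym in-family) not-in-family) λ ()
          where
          e′∈ : present e′ ≡ true
          e′∈ = saturated {a} {e′} a∉ (covers⁺ {p = a} (⊆e′ ∘ q⊆p∪q (∁ e) (∁ a))) ∣e′∣
          l′ : e′ - x ⋖ e′
          l′ = p-x⋖p (⊆e′ (q⊆p∪q (∁ e) (∁ a) (x∉p⇒x∈∁p x∉a)))
          x∉ : x ∉ e′ - x
          x∉ = x∉p-x e′
          ∁e⊆ : ∁ e ⊆ e′ - x
          ∁e⊆ y∈ = x∈p∧x≢y⇒x∈p-y (⊆e′ (p⊆p∪q (∁ a) y∈)) λ y≡x → x∈∁p⇒x∉p y∈ (subst (_∈ e) (sym y≡x) x∈e)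
          in-family : f (inside ∷ (e′ - x)) ≡ true
          in-family = adm .stable (move l′) e′∈
          not-in-family : f (inside ∷ (e′ - x)) ≡ false
          not-in-family = proj₂ (missing⁻ {k = k₁} (f ∘ (inside ∷_)) {e′ - x}
            (star-absent (suc-injective (trans (⋖-card l′) ∣e′∣)) (covers⁺ {p = e} ∁e⊆) (not-covers x∉)))

    absent-avoiding : ∀ {e g} → present e ≡ true → g ⋖ e → ∃ λ a → absent a ≡ true × covers g a ≡ true
    absent-avoiding {e} {g} e∈ l = decidable-stable
      (anySubset? λ a → (absent a Bool.≟ true) ×-dec (covers g a Bool.≟ true))
      (star-contradiction e∈ l)

    -- An absent `a` covering `g` also covers every `e′` above `g`, which is then present by
    -- `saturated`.
    exchange : Exchangeable (λ e → present e ≡ true)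
    exchange {g} {e} {e′} l l′ e∈ with absent-avoiding e∈ l
    ... | a , a∉ , cov = saturated {a} {e′} a∉ (trans (covers-comm a e′) (covers-⋖ {r = a} l′ cov))
      (trans (sym (⋖-card l′)) (trans (⋖-card l) (present-size e∈)))

    -- From one present set, exchanges reach all `suc k₁`-sets. Enlarging an absent `a` by one
    -- element then gives a present set, and trading that element for 0 puts `a ∪ {0}` into the
    -- family.
    none-present : ∀ {e} → present e ≢ true
    none-present {e} e∈ with ⋖-below e (≤-trans (s≤s z≤n) (≤-reflexive (sym (present-size e∈))))
    ... | g , l with absent-avoiding e∈ l
    ...   | a , a∉ , _ with missing⁻ {k = k₁} (f ∘ (inside ∷_)) {a} a∉
    ...     | ∣a∣ , fa
      with ⋖-above a (≤-trans (≤-trans (≤-reflexive (cong suc ∣a∣)) (m≤m+n (suc k₁) s)) (≤-reflexive (sym ground≡)))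
    ...       | e′ , l′ = contradiction (trans (sym (adm .stable (move l′) e′∈)) fa) λ ()
      where
      e′∈ : present e′ ≡ true
      e′∈ = exchange-connected (λ e → present e ≡ true) exchange e e′
        (trans (present-size e∈) (trans (cong suc (sym ∣a∣)) (⋖-card l′))) e∈

  strict-bound : s ≤ k′ → ∀ {e} → present e ≡ true → layer ground (suc k₁) < #missing (suc k₁) f
  strict-bound s≤k′ {e} e∈ = ≤∧≢⇒< bound λ eq →
    -- Equality in `bound` cancels to the hypothesis `tight`.
    Tight.none-present s≤k′ (+-cancelʳ-≤ _ _ _ (≤-reflexive (trans (sym eq) layer≡))) {e} e∈

-- Both counts split over the last element, `layer` by Pascal's rule. For strictness, a member
-- avoiding 0 can be made to avoid the last element too, since `k < m` leaves a free element to move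
-- it to.
split-last : ∀ {f : Subset (suc (suc m)) → Bool} → k < m → Admissible c (suc k) f →
  Bound c k (λ A → f (A ∷ʳ inside)) → Bound c (suc k) (λ A → f (A ∷ʳ outside)) → Bound c (suc k) f
split-last {m} {k} {c} {f} k<m adm (le₁ , _) (le₀ , lt₀) =
  ≤-trans (+-mono-≤ le₁ le₀) (≤-reflexive (sym eq)) ,
  λ 2≤c e∈ → ≤-trans (+-mono-≤-< le₁ (lt₀ 2≤c (proj₂ (avoid-last e∈)))) (≤-reflexive (sym eq))
  where
  eq : #missing (suc k) f ≡ #missing k (λ A → f (A ∷ʳ inside)) + #missing (suc k) (λ A → f (A ∷ʳ outside))
  eq = trans (∑-∷ʳ (𝟙 ∘ missing (suc k) f)) (cong₂ _+_
    (∑-cong λ A → cong (λ j → 𝟙 ((j ≡ᵇ suc k) ∧ not (f (A ∷ʳ inside)))) (∣∷ʳ∣-in A))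
    (∑-cong λ A → cong (λ j → 𝟙 ((j ≡ᵇ suc k) ∧ not (f (A ∷ʳ outside)))) (∣∷ʳ∣-out A)))
  avoid-last : ∀ {e} → f (outside ∷ e) ≡ true → ∃ λ e′ → f (outside ∷ (e′ ∷ʳ outside)) ≡ true
  avoid-last {e} e∈ with initLast e
  ... | e′ , false , refl = e′ , e∈
  ... | e′ , true  , refl
    with ⋖-above e′ (≤-trans (≤-reflexive (trans (sym (∣∷ʳ∣-in e′)) (adm .uniform e∈))) k<m)
  ...   | e″ , l = e″ , adm .stable (skip (⋖⇒∷ʳ-⊲ l)) e∈

-- With d = c + 1 and n = m + 1, suc s is n - k and k ≤ c * suc s says dk ≤ (d - 1)n.
missing-bound : ∀ c k s m → m ≡ k + s → c ≤ k → k ≤ c * suc s →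
  (f : Subset (suc m) → Bool) → Admissible c k f → Bound c k f
missing-bound c k s m m≡ c≤k k≤ f adm with m≤n⇒m<n∨m≡n c≤k | k ≤? c * s
missing-bound c k s m m≡ c≤k k≤ f adm | inj₂ refl | _ =
  ≤-trans (≤-reflexive (avoiding-0 {f = f} (tight-avoids-0 adm))) (m≤n+m _ _) ,
  λ _ {e} e∈ → contradiction (trans (sym e∈) (tight-avoids-0 adm e)) λ ()
missing-bound c (suc k) zero m m≡ c≤k k≤ f adm | inj₁ _ | yes k≤c0 =
  contradiction (≤-trans k≤c0 (≤-reflexive (*-zeroʳ c))) λ ()
missing-bound c (suc k) (suc s) (suc m) m≡ c≤k k≤ f adm | inj₁ (s≤s c≤k′) | yes k≤cs =
  split-last k<m adm
    (missing-bound c k (suc s) m (suc-injective m≡) c≤k′ (<⇒≤ k≤) _ (last-in {s = suc s} n≡ k≤ adm))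
    (missing-bound c (suc k) s m (trans (suc-injective m≡) (+-suc k s)) c≤k k≤cs _ (last-out adm))
  where
  n≡ : suc m ≡ k + suc (suc s)
  n≡ = trans m≡ (sym (+-suc k (suc s)))
  k<m : k < m
  k<m = ≤-trans (m<m+n k (s≤s z≤n)) (≤-reflexive (sym (suc-injective m≡)))
missing-bound zero (suc k) s m m≡ c≤k () f adm | inj₁ _ | no _
missing-bound (suc c) (suc k) zero m m≡ c≤k k≤ f adm | inj₁ c<k | no _ =
  contradiction (≤-trans c<k (≤-trans k≤ (≤-reflexive (*-identityʳ (suc c))))) (<-irrefl refl)
missing-bound (suc c) (suc k) s@(suc s′) m m≡ c≤k k≤ f adm | inj₁ c<k | no k≰cs =
  -- Here `d ≥ 3` means `1 ≤ c`, whence `s ≤ c * s ≤ k′`.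
  bound , λ { (s≤s 1≤c) {e} → strict-bound (≤-trans (m≤n*m s c {{>-nonZero 1≤c}}) cs≤k′) {e} }
  where
  -- `k′` is `suc k` minus the codimension `suc s`. A link lives on `suc k` points, so its
  -- codimension is again `suc s`.
  k′ : ℕ
  k′ = k ∸ s
  s+cs≤k : s + c * s ≤ k
  s+cs≤k = ≤-pred (≰⇒> k≰cs)
  k≡ : k ≡ k′ + s
  k≡ = sym (m∸n+n≡m (≤-trans (m≤m+n s (c * s)) s+cs≤k))
  cs≤k′ : c * s ≤ k′
  cs≤k′ = m+n≤o⇒m≤o∸n (c * s) (≤-trans (≤-reflexive (+-comm (c * s) s)) s+cs≤k)
  c≤k′ : c ≤ k′
  c≤k′ = ≤-trans (m≤m*n c s) cs≤k′
  k′≤ : k′ ≤ c * suc s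
  k′≤ = m≤n+o⇒m∸n≤o k s (≤-pred k≤)
  k′+ : k′ + suc m ≡ suc k + suc k
  k′+ = begin
    k′ + suc m               ≡⟨ cong (λ z → k′ + suc z) (trans m≡ (+-comm (suc k) s)) ⟩
    k′ + suc (s + suc k)     ≡⟨ +-suc k′ (s + suc k) ⟩
    suc (k′ + (s + suc k))   ≡⟨ cong suc (+-assoc k′ s (suc k)) ⟨
    suc (k′ + s + suc k)     ≡⟨ cong (λ z → suc (z + suc k)) k≡ ⟨
    suc k + suc k            ∎
    where open ≡-Reasoning
  -- The whole ground set satisfies the size condition, so any `d` members meet.
  size : suc m + suc c ≤ suc (2 * suc k)
  size = s≤s (begin
    m + suc c               ≡⟨ cong (_+ suc c) m≡ ⟩
    suc k + s + suc c       ≡⟨ +-assoc (suc k) s (suc c) ⟩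
    suc k + (s + suc c)     ≡⟨ cong (suc k +_) (+-suc s c) ⟩
    suc k + suc (s + c)     ≤⟨ +-monoʳ-≤ (suc k) (s≤s (≤-trans (+-monoʳ-≤ s (m≤m*n c s)) s+cs≤k)) ⟩
    suc k + suc k           ≡⟨ cong (suc k +_) (+-identityʳ (suc k)) ⟨
    2 * suc k               ∎)
    where open ≤-Reasoning
  -- Generalised over `n`, because `∣ e ∣` equals `suc k` only propositionally.
  link-bound : ∀ {n} → n ≡ suc k → (g : Subset n → Bool) → Admissible c k′ g → layer k k′ ≤ #missing k′ g
  link-bound refl g adm′ = proj₁ (missing-bound c k′ s k k≡ c≤k′ k′≤ g adm′)
  open Boundary (suc c) k′ s k m k≡ m≡ f adm
    (λ e e∈ → link-bound (adm .uniform e∈) (link f e) (link-admissible k′+ size e∈ adm))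

-- Families given by lists

indicator : Family n → Subset n → Bool
indicator F A = does (A ∈ᶠ? F)

indicator⁻ : ∀ (F : Family n) {A} → indicator F A ≡ true → A ∈ᶠ F
indicator⁻ F {A} h with A ∈ᶠ? F
... | yes A∈F = A∈F
... | no _    = contradiction h λ ()

indicator⁺ : ∀ {F : Family n} {A} → A ∈ᶠ F → indicator F A ≡ true
indicator⁺ {F = F} {A} = dec-true (A ∈ᶠ? F)

∑-point : (B : Subset n) → ∑ (λ A → 𝟙 (does (A ≟ˢ B))) ≡ 1
∑-point []                  = refl
∑-point {suc n} (true  ∷ B) = trans (cong₂ _+_ (∑-point B) (∑-0 {n})) refl
∑-point {suc n} (false ∷ B) = cong₂ _+_ (∑-0 {n}) (∑-point B)

length≡∑ : {F : Family n} → Unique F → length F ≡ ∑ (𝟙 ∘ indicator F)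
length≡∑ {n} {[]} [] = sym (∑-0 {n})
length≡∑ {n} {B ∷ F} (B∉F ∷ unique) = sym (begin
  ∑ (𝟙 ∘ indicator (B ∷ F))                                   ≡⟨ ∑-cong pointwise ⟩
  ∑ (λ A → 𝟙 (does (A ≟ˢ B)) + 𝟙 (indicator F A))             ≡⟨ ∑-+ (λ A → 𝟙 (does (A ≟ˢ B))) (𝟙 ∘ indicator F) ⟩
  ∑ (λ A → 𝟙 (does (A ≟ˢ B))) + ∑ (𝟙 ∘ indicator F)           ≡⟨ cong₂ _+_ (∑-point B) (sym (length≡∑ unique)) ⟩
  suc (length F)                                              ∎)
  where
  open ≡-Reasoning
  pointwise : ∀ A → 𝟙 (indicator (B ∷ F) A) ≡ 𝟙 (does (A ≟ˢ B)) + 𝟙 (indicator F A)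
  pointwise A with A ≟ˢ B
  ... | no _ = refl
  ... | yes refl with A ∈ᶠ? F
  ...   | no _    = refl
  ...   | yes A∈F = contradiction refl (All.lookup B∉F A∈F)

shiftSet≡ : ∀ (F : Family n) {i j A} → j ∈ A → i ∉ A → ¬ (replace i j A ∈ᶠ F) →
  shiftSet F i j A ≡ replace i j A
shiftSet≡ F {i} {j} {A} j∈ i∉ ∉F
  rewrite dec-true ((j ∈? A) ×-dec ¬? (i ∈? A) ×-dec ¬? (replace i j A ∈ᶠ? F)) (j∈ , i∉ , ∉F) = refl

-- If `p` were not in `F`, the shift would move `q` to `p`; but `shift i j F` has the same members
-- as `F`.
Stable⇒ : {F : Family n} → Stable F → p ⊲ q → q ∈ᶠ F → p ∈ᶠ F
Stable⇒ {p = p} {q} {F} stableF l q∈F with ⊲⇒replace l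
... | i , j , i<j , j∈q , i∉q , refl with replace i j q ∈ᶠ? F
...   | yes p∈F = p∈F
...   | no p∉F = Equivalence.to (stableF i j i<j)
  (subst (_∈ᶠ shift i j F) (shiftSet≡ F j∈q i∉q p∉F) (∈-map⁺ (shiftSet F i j) q∈F))

⋃-⊆ : ∀ {d} (A : Fin d → Subset n) {U} → (∀ i → A i ⊆ U) → ⋃ (tabulate A) ⊆ U
⋃-⊆ {d = zero}  A A⊆U x∈ = ⊥-elim (∉⊥ x∈)
⋃-⊆ {d = suc d} A A⊆U x∈ with x∈p∪q⁻ (A zero) _ x∈
... | inj₁ x∈A = A⊆U zero x∈A
... | inj₂ x∈⋃ = ⋃-⊆ (A ∘ suc) (λ i → A⊆U (suc i)) x∈⋃

⋂⁻ : ∀ {d} (A : Fin d → Subset n) {x} → x ∈ ⋂ (tabulate A) → ∀ i → x ∈ A i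
⋂⁻ A x∈ zero    = proj₁ (x∈p∩q⁻ (A zero) _ x∈)
⋂⁻ A x∈ (suc i) = ⋂⁻ (A ∘ suc) (proj₂ (x∈p∩q⁻ (A zero) _ x∈)) i

indicator-admissible : {F : Family n} → Uniform k F → Stable F → IntersectionCondition k (suc (suc c)) F →
  Admissible (suc c) k (indicator F)
indicator-admissible {F = F} _ stableF _ .stable l h = indicator⁺ (Stable⇒ stableF l (indicator⁻ F h))
indicator-admissible {F = F} uniformF _ _ .uniform h = All.lookup uniformF (indicator⁻ F h)
indicator-admissible {k = k} {c} {F} _ _ meetF .meet A inj A∈ U A⊆U size
  with meetF A inj (λ i → indicator⁻ F (A∈ i)) (m+n≤o⇒m≤o∸n _ (begin
    ∣ ⋃ (tabulate A) ∣ + c    ≤⟨ +-monoˡ-≤ c (p⊆q⇒∣p∣≤∣q∣ (⋃-⊆ A A⊆U)) ⟩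
    -- `d ∸ 2` is `c` here while the record has `suc c`; the difference cancels against the 1 added
    -- to `2 * k`.
    ∣ U ∣ + c                 ≤⟨ ≤-pred (≤-trans (≤-reflexive (sym (+-suc ∣ U ∣ c))) size) ⟩
    2 * k                     ∎))
  where open ≤-Reasoning
... | x , x∈ = x , ⋂⁻ A x∈

-- Stars and the equality case

∣insertAt∣ : (A : Subset n) (x : Fin (suc n)) → ∣ insertAt A x inside ∣ ≡ suc ∣ A ∣
∣insertAt∣ A           zero    = refl
∣insertAt∣ (true  ∷ A) (suc x) = cong suc (∣insertAt∣ A x)
∣insertAt∣ (false ∷ A) (suc x) = ∣insertAt∣ A x

insertAt-∈ : (A : Subset n) (x : Fin (suc n)) → x ∈ insertAt A x inside
insertAt-∈ A       zero    = here
insertAt-∈ (_ ∷ A) (suc x) = there (insertAt-∈ A x)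

insertAt-∉ : (A : Subset n) (x : Fin (suc n)) → x ∉ insertAt A x outside
insertAt-∉ (_ ∷ A) (suc x) (there x∈) = insertAt-∉ A x x∈

star-count : {F : Family (suc n)} → IsStar (suc k) F → ∑ (𝟙 ∘ indicator F) ≡ layer n k
star-count {n} {k} {F} (x , star) = begin
  ∑ (𝟙 ∘ indicator F)
    ≡⟨ ∑-insertAt (𝟙 ∘ indicator F) x ⟩
  ∑ (λ A → 𝟙 (indicator F (insertAt A x inside))) + ∑ (λ A → 𝟙 (indicator F (insertAt A x outside)))
    ≡⟨ cong₂ _+_ (∑-cong λ A → cong 𝟙 (with-x A)) (trans (∑-cong λ A → cong 𝟙 (without-x A)) (∑-0 {n})) ⟩
  layer n k + 0
    ≡⟨ +-identityʳ _ ⟩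
  layer n k
    ∎
  where
  open ≡-Reasoning
  with-x : ∀ A → indicator F (insertAt A x inside) ≡ (∣ A ∣ ≡ᵇ k)
  with-x A = does-⇔ (mk⇔
    (λ A∈ → suc-injective (trans (sym (∣insertAt∣ A x)) (proj₁ (Equivalence.to (star _) A∈))))
    (λ size → Equivalence.from (star _) (trans (∣insertAt∣ A x) (cong suc size) , insertAt-∈ A x)))
    (insertAt A x inside ∈ᶠ? F) (∣ A ∣ ≟ k)
  without-x : ∀ A → indicator F (insertAt A x outside) ≡ false
  without-x A = dec-false (insertAt A x outside ∈ᶠ? F)
    λ A∈ → insertAt-∉ A x (proj₂ (Equivalence.to (star _) A∈))

none-missing⇒present : ∀ {f : Subset n → Bool} → #missing k f ≡ 0 → ∀ {A} → ∣ A ∣ ≡ k → f A ≡ true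
none-missing⇒present {k = k} {f} none {A} size with f A in A∉
... | true  = refl
... | false = contradiction (trans (∑-tight {u = λ _ → 0} {𝟙 ∘ missing k f} (λ _ → z≤n)
  (≤-trans (≤-reflexive none) z≤n) A) (cong 𝟙 (missing⁺ {k = k} {f} {A} size A∉))) λ ()

-- With `d = c + 2` and sets of size `suc k`, the codimension is `suc s`. Subtracting
-- `(d - 1)(k + 1)` from both sides of the hypothesis gives the last inequality.
ground-size : ∀ {n k c} → suc (suc c) * suc k ≤ suc c * n → ∃ λ s → n ≡ suc (suc k + s) × suc k ≤ suc c * suc s
ground-size {n} {k} {c} le with m≤n⇒∃[o]m+o≡n k<n
  where
  open ≤-Reasoning
  k<n : suc k < n
  k<n = *-cancelˡ-< (suc c) (suc k) n (<-≤-trans (m<n+m _ (s≤s z≤n)) le)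
... | s , refl = s , refl , +-cancelʳ-≤ (suc c * suc k) (suc k) (suc c * suc s) (begin
  suc k + suc c * suc k             ≤⟨ le ⟩
  suc c * (suc (suc k) + s)         ≡⟨ cong (suc c *_) (cong suc (+-comm (suc k) s)) ⟩
  suc c * (suc s + suc k)           ≡⟨ *-distribˡ-+ (suc c) (suc s) (suc k) ⟩
  suc c * suc s + suc c * suc k     ∎)
  where open ≤-Reasoning

theorem5 : (n k d : ℕ) → 3 ≤ d → d ≤ k → d * k ≤ (d ∸ 1) * n →
    (F : Family n) → Unique F → Uniform k F → Stable F →
    IntersectionCondition k d F →
    (length F ≤ (n ∸ 1) C (k ∸ 1)) ×
    ((length F ≡ (n ∸ 1) C (k ∸ 1)) ⇔ IsStar k F)
theorem5 n (suc k) (suc (suc (suc c))) (s≤s (s≤s (s≤s _))) (s≤s d≤k) dk≤ F unique uniformF stableF meetF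
  with ground-size {n} {k} {suc c} dk≤
... | s , refl , k≤ = upper , mk⇔ only-stars stars
  where
  N : ℕ
  N = suc k + s
  χ : Subset (suc N) → Bool
  χ = indicator F
  adm : Admissible (suc (suc c)) (suc k) χ
  adm = indicator-admissible uniformF stableF meetF
  bound : Bound (suc (suc c)) (suc k) χ
  bound = missing-bound (suc (suc c)) (suc k) s N refl (≤-trans d≤k (n≤1+n k)) k≤ χ adm
  total : layer N k + layer N (suc k) ≡ length F + #missing (suc k) χ
  total = trans (layer-split {f = χ} (adm .uniform)) (cong (_+ #missing (suc k) χ) (sym (length≡∑ unique)))
  upper : length F ≤ N C k
  upper = ≤-trans (+-cancelʳ-≤ _ _ _ (≤-trans (+-monoʳ-≤ (length F) (proj₁ bound)) (≤-reflexive (sym total))))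
    (≤-reflexive (layer≡C N k))
  stars : IsStar (suc k) F → length F ≡ N C k
  stars star = trans (length≡∑ unique) (trans (star-count star) (layer≡C N k))
  only-stars : length F ≡ N C k → IsStar (suc k) F
  only-stars eq = zero , λ A → mk⇔ (to A) (from A)
    where
    missing≡ : #missing (suc k) χ ≡ layer N (suc k)
    missing≡ = +-cancelˡ-≡ (layer N k) _ _
      (sym (trans total (cong (_+ #missing (suc k) χ) (trans eq (sym (layer≡C N k))))))
    contains-0 : ∀ e → χ (outside ∷ e) ≡ false
    contains-0 e with χ (outside ∷ e) in e∈
    ... | false = refl
    -- A member avoiding 0 makes the bound strict, against `missing≡`.
    ... | true  = contradiction (proj₂ bound (s≤s (s≤s z≤n)) {e} e∈) (<-irrefl (sym missing≡))
    -- The sets avoiding 0 are all missing and already account for the whole number of missing sets.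
    none-missing : #missing k (χ ∘ (inside ∷_)) ≡ 0
    none-missing = n≤0⇒n≡0 (+-cancelʳ-≤ (layer N (suc k)) _ _ (begin
      #missing k (χ ∘ (inside ∷_)) + layer N (suc k)
        ≤⟨ +-monoʳ-≤ (#missing k (χ ∘ (inside ∷_))) (≤-reflexive (avoiding-0 {f = χ} contains-0)) ⟩
      #missing (suc k) χ
        ≡⟨ missing≡ ⟩
      layer N (suc k)
        ∎))
      where open ≤-Reasoning
    to : ∀ A → A ∈ᶠ F → ∣ A ∣ ≡ suc k × zero ∈ A
    to A A∈ = All.lookup uniformF A∈ , zero∈ A (indicator⁺ A∈)
      where
      zero∈ : ∀ A → χ A ≡ true → zero ∈ A
      zero∈ (true  ∷ A) _ = here
      zero∈ (false ∷ A) h = contradiction (trans (sym h) (contains-0 A)) λ ()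
    from : ∀ A → ∣ A ∣ ≡ suc k × zero ∈ A → A ∈ᶠ F
    from (true ∷ A) (size , here) =
      indicator⁻ F (none-missing⇒present {f = χ ∘ (inside ∷_)} none-missing (suc-injective size))
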